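{- There is a constant $c>0$ such that the following holds. Let $k\in\mathbb N$ and let $\Pi$ be a prefix of $k$ temporal operators among $\mathsf X$, $\mathsf F$ and $\mathsf G$. Let $\phi$ be a formula of $\mathsf F(\mathrm{LTL}[\mathsf O])$ and $\psi$ a formula of $\mathrm{LTL}[\mathsf X,\mathsf{wX},\mathsf F,\mathsf G]$ with $\phi\equiv_\omega\psi$. Then the minimal deterministic Büchi automaton for $\mathcal L^\omega(\Pi(\psi))$ has at most $(k+1)\cdot2^{c\cdot\mathrm{size}(\phi)}$ states.
   Context: Let $AP$ be a finite set of atomic propositions and $\Sigma=2^{AP}$. Formulae (negation normal form) are built from literals $p,\neg p$ ($p\in AP$) with $\land,\lor$ and temporal operators $\mathsf X,\mathsf{wX},\mathsf F,\mathsf G,\mathsf O$ (among others). Infinite-trace semantics on $\sigma\in\Sigma^\omega$ at positions $i\in\mathbb N$: literals/Booleans as usual; $\mathsf X\phi$ and $\mathsf{wX}\phi$: $\phi$ holds at $i+1$; $\mathsf F\phi$/$\mathsf G\phi$: $\phi$ at some/every $j\ge i$; $\mathsf O\phi$: $\phi$ at some $0\le j\le i$. $\mathcal L^\omega(\phi)=\{\sigma\in\Sigma^\omega:\sigma,0\models\phi\}$ and $\phi\equiv_\omega\psi$ iff $\mathcal L^\omega(\phi)=\mathcal L^\omega(\psi)$. Size: literals 1, unary operators add 1, binary connectives sum plus 1. $\mathrm{LTL}[S]$: formulae whose temporal operators lie in $S$; $\mathsf F(\mathrm{LTL}[S])$: formulae $\mathsf F(\alpha)$ with $\alpha\in\mathrm{LTL}[S]$.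 $\Pi(\psi)$ denotes the formula obtained by prefixing $\psi$ with the sequence of operators $\Pi$. A deterministic Büchi automaton (DBA) is $(Q,\Sigma,\delta,q_0,F)$ with finite state set $Q$, total transition function $\delta:Q\times\Sigma\to Q$, initial state $q_0$ and accepting set $F\subseteq Q$; it accepts $\sigma\in\Sigma^\omega$ iff its unique run on $\sigma$ visits $F$ infinitely often. The size of a DBA is its number of states. -}

module Defs where

open import Data.Fin using (Fin)
open import Data.Fin.Subset using (Subset; _∈_; _∉_)
open import Data.List using (List)
import Data.List.Membership.Propositional as List
open import Data.Nat using (ℕ; zero; suc; _+_; _≤_)
open import Data.Product using (_×_; ∃-syntax)
open import Data.Sum using (_⊎_)
open import Data.Vec using (Vec; []; _∷_)
open import Level using (0ℓ)
open import Relation.Unary using (Pred; _≐_)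

-- AP is the n-element set Fin n, and Σ = 2^AP.
Letter : ℕ → Set
Letter n = Subset n

Trace : ℕ → Set
Trace n = ℕ → Letter n

data Op : Set where
  X wX F G O : Op

infixr 6 _∧_
infixr 5 _∨_

data Formula (n : ℕ) : Set where
  pos neg : (p : Fin n) → Formula n
  _∧_ _∨_ : (φ ψ : Formula n) → Formula n
  op      : (o : Op) (φ : Formula n) → Formula n

size : ∀ {n} → Formula n → ℕ
size (pos p)  = 1
size (neg p)  = 1
size (φ ∧ ψ)  = size φ + size ψ + 1
size (φ ∨ ψ)  = size φ + size ψ + 1
size (op o φ) = size φ + 1

infix 4 _,_⊨_

_,_⊨_ : ∀ {n} → Trace n → ℕ → Formula n → Set
σ , i ⊨ pos p   = p ∈ σ i
σ , i ⊨ neg p   = p ∉ σ i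
σ , i ⊨ φ ∧ ψ   = (σ , i ⊨ φ) × (σ , i ⊨ ψ)
σ , i ⊨ φ ∨ ψ   = (σ , i ⊨ φ) ⊎ (σ , i ⊨ ψ)
σ , i ⊨ op X φ  = σ , suc i ⊨ φ
-- On infinite traces weak next coincides with next.
σ , i ⊨ op wX φ = σ , suc i ⊨ φ
σ , i ⊨ op F φ  = ∃[ j ] (i ≤ j × (σ , j ⊨ φ))
σ , i ⊨ op G φ  = ∀ j → i ≤ j → σ , j ⊨ φ
σ , i ⊨ op O φ  = ∃[ j ] (j ≤ i × (σ , j ⊨ φ))

Language : ℕ → Set₁
Language n = Pred (Trace n) 0ℓ

ℒω : ∀ {n} → Formula n → Language n
ℒω φ σ = σ , 0 ⊨ φ

infix 4 _≡ω_

_≡ω_ : ∀ {n} → Formula n → Formula n → Set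
φ ≡ω ψ = ℒω φ ≐ ℒω ψ

data LTL[_] {n : ℕ} (S : List Op) : Formula n → Set where
  pos : ∀ p → LTL[ S ] (pos p)
  neg : ∀ p → LTL[ S ] (neg p)
  _∧_ : ∀ {φ ψ} → LTL[ S ] φ → LTL[ S ] ψ → LTL[ S ] (φ ∧ ψ)
  _∨_ : ∀ {φ ψ} → LTL[ S ] φ → LTL[ S ] ψ → LTL[ S ] (φ ∨ ψ)
  op  : ∀ {o φ} → o List.∈ S → LTL[ S ] φ → LTL[ S ] (op o φ)

data F⟨LTL[_]⟩ {n : ℕ} (S : List Op) : Formula n → Set where
  F : ∀ {α} → LTL[ S ] α → F⟨LTL[ S ]⟩ (op F α)

-- The first entry of the vector becomes the outermost operator.
prefix : ∀ {k n} → Vec Op k → Formula n → Formula n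
prefix []      ψ = ψ
prefix (o ∷ Π) ψ = op o (prefix Π ψ)

record DBA (n : ℕ) : Set where
  field
    states : ℕ
    δ      : Fin states → Letter n → Fin states
    q₀     : Fin states
    final  : Subset states

  run : Trace n → ℕ → Fin states
  run σ zero    = q₀
  run σ (suc i) = δ (run σ i) (σ i)

  Accepts : Language n
  Accepts σ = ∀ i → ∃[ j ] (i ≤ j × run σ j ∈ final)

open DBA public using (states)

_Recognises_ : ∀ {n} → DBA n → Language n → Set
A Recognises L = DBA.Accepts A ≐ L

IsMinimalDBAFor : ∀ {n} → Language n → DBA n → Set
IsMinimalDBAFor L A = A Recognises L × (∀ B → B Recognises L → states A ≤ states B)

{-# OPTIONS --safe #-}

-- Formulae of LTL[O] contain no universal past operator, so F(α) is preserved
-- when letters are added in front of a trace. Hence ψ holds at every position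
-- before one where it holds, which gives F ψ ≡ ψ, F X ψ ≡ X ψ, G X ψ ≡ G ψ and so
-- on: Π(ψ) is equivalent to Xᵐ ψ with m ≤ k, or to G ψ. One bit per operator O
-- makes α deterministic; F α needs one more bit (α has held), and so does G ψ,
-- where the automaton restarts, and accepts, each time α holds. A leading X costs
-- one state. That a minimal automaton exists constructively rests on deciding
-- inclusion of Büchi automata and enumerating the automata of a given size.

module Submission where

open import Data.Bool using (Bool; T; false; if_then_else_; true) renaming (_∧_ to _∧ᵇ_; _∨_ to _∨ᵇ_)
open import Data.Bool.Properties using (T-∧; T-∨; T-≡)
open import Data.Empty using (⊥-elim)
open import Data.Fin using (Fin; combine; finToFun; funToFin; suc; toℕ; zero)
open import Data.Fin.Properties using (*↔×; 1↔⊤; 2↔Bool; any?; combine-injective; finToFun-funToFin; pigeonhole) renaming (_≟_ to _≟ᶠ_)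
open import Data.Fin.Subset using (Subset; outside) renaming (_∈_ to _∈ₛ_; _∉_ to _∉ₛ_)
open import Data.Fin.Subset.Properties using (_∈?_; anySubset?; drop-there)
open import Data.List using (List; []; _∷_; allFin; cartesianProduct)
open import Data.List.Membership.Propositional using (_∈_)
open import Data.List.Membership.Propositional.Properties using (∈-allFin; ∈-cartesianProduct⁺)
open import Data.List.Relation.Unary.Any using (here; there)
open import Data.Nat using (_*_; _+_; _<_; _<′_; _^_; _∸_; _≤_; suc; s≤s; s≤s⁻¹; zero; z≤n; ℕ; ≤′-refl; ≤′-step)
open import Data.Nat.Properties using (*-distribʳ-+; *-identityˡ; *-mono-≤; *-monoˡ-≤; +-assoc; +-comm; +-identityʳ; +-mono-≤; +-monoʳ-≤; +-monoˡ-≤; +-suc; <⇒≤; ^-distribˡ-+-*; ^-monoʳ-≤; m+n≤o⇒m≤o∸n; m^n≢0; module ≤-Reasoning; m∸n+n≡m; m≤m*n; m≤m+n; m≤n+m; m≤n⇒m<n∨m≡n; m≤n⇒m≤1+n; n<1+n; n≤1+n; ≤-refl; ≤-reflexive; ≤-trans; ≤′⇒≤; ≤⇒≤′)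
open import Data.Product using (_,_; _×_; map₂; proj₁; proj₂; ∃; ∃-syntax)
open import Data.Product.Function.NonDependent.Propositional using (_×-↔_; _×-⇔_)
open import Data.Product.Properties using (≡-dec)
open import Data.Sum using (_⊎_; inj₁; inj₂)
open import Data.Sum.Function.Propositional using (_⊎-⇔_)
open import Data.Unit using (tt; ⊤)
open import Data.Vec using (Vec; []; _∷_; lookup; tabulate; there)
open import Data.Vec.Properties using ([]=⇒lookup; lookup⇒[]=; lookup∘tabulate; tabulate-cong; tabulate∘lookup)
open import Data.Vec.Relation.Unary.All using (All; []; _∷_)
open import Function using (Equivalence; Inverse; _↔_; _⇔_; _∘_; mk⇔)
open import Function.Properties.Equivalence using () renaming (refl to ⇔-refl; sym to ⇔-sym; trans to ⇔-trans)
open import Function.Properties.Inverse using (↔-sym; ↔-trans)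
open import Level using (0ℓ; Level)
open import Relation.Binary using (Rel) renaming (Decidable to Decidable₂)
open import Relation.Binary.Construct.Closure.Transitive using (TransClosure; [_]; _++_; _∷_; _∷ʳ_)
open import Relation.Binary.PropositionalEquality using (_≡_; cong; cong₂; refl; subst; sym; trans)
open import Relation.Nullary using (Dec; no; yes; ¬_; ⌊_⌋)
open import Relation.Nullary.Decidable using (_×-dec_; _⊎-dec_; fromWitness; toWitness; ¬?) renaming (map′ to mapDec)
open import Relation.Unary using (Decidable; Pred; _≐_; _⊆_)
open import Relation.Unary.Properties using (≐-sym; ≐-trans)
open import Defs

open Equivalence using (to; from)

private
  variable
    n : ℕ

-- Transitive closure on a finite type

-- Floyd–Warshall: paths all of whose intermediate points lie in the list.
module _ {a ℓ : Level} {A : Set a} (E : Rel A ℓ) where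

  Via : List A → Rel A ℓ
  Via []       p q = E p q
  Via (x ∷ xs) p q = Via xs p q ⊎ (Via xs p x × Via xs x q)

  via? : Decidable₂ E → ∀ xs → Decidable₂ (Via xs)
  via? E? []       p q = E? p q
  via? E? (x ∷ xs) p q = via? E? xs p q ⊎-dec (via? E? xs p x ×-dec via? E? xs x q)

  via⇒closure : ∀ xs {p q} → Via xs p q → TransClosure E p q
  via⇒closure []       e              = [ e ]
  via⇒closure (x ∷ xs) (inj₁ v)       = via⇒closure xs v
  via⇒closure (x ∷ xs) (inj₂ (v , w)) = via⇒closure xs v ++ via⇒closure xs w

  edge⇒via : ∀ xs {p q} → E p q → Via xs p q
  edge⇒via []       e = e
  edge⇒via (x ∷ xs) e = inj₁ (edge⇒via xs e)

  via-to-pivot : ∀ x xs p → Via (x ∷ xs) p x → Via xs p x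
  via-to-pivot x xs _ (inj₁ v)       = v
  via-to-pivot x xs _ (inj₂ (v , _)) = v

  via-from-pivot : ∀ x xs q → Via (x ∷ xs) x q → Via xs x q
  via-from-pivot x xs _ (inj₁ v)       = v
  via-from-pivot x xs _ (inj₂ (_ , v)) = v

  -- The meeting point `q` becomes an intermediate point, hence `q ∈ xs`. If it is the pivot, both
  -- paths are cut there. If both paths pass through the pivot elsewhere, the loop between the two
  -- visits is dropped.
  via-trans : ∀ xs {p q r} → q ∈ xs → Via xs p q → Via xs q r → Via xs p r
  via-trans (x ∷ xs) (here refl) v w = inj₂ (via-to-pivot x xs _ v , via-from-pivot x xs _ w)
  via-trans (x ∷ xs) (there q∈) (inj₁ v) (inj₁ w) = inj₁ (via-trans xs q∈ v w)
  via-trans (x ∷ xs) (there q∈) (inj₁ v) (inj₂ (w , w′)) = inj₂ (via-trans xs q∈ v w , w′)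
  via-trans (x ∷ xs) (there q∈) (inj₂ (v , v′)) (inj₁ w) = inj₂ (v , via-trans xs q∈ v′ w)
  via-trans (x ∷ xs) (there q∈) (inj₂ (v , _)) (inj₂ (_ , w)) = inj₂ (v , w)

  closure⇒via : ∀ xs → (∀ x → x ∈ xs) → ∀ {p q} → TransClosure E p q → Via xs p q
  closure⇒via xs complete [ e ]    = edge⇒via xs e
  closure⇒via xs complete (e ∷ es) = via-trans xs (complete _) (edge⇒via xs e) (closure⇒via xs complete es)

  closure? : Decidable₂ E → ∀ xs → (∀ x → x ∈ xs) → Decidable₂ (TransClosure E)
  closure? E? xs complete p q = mapDec (via⇒closure xs) (closure⇒via xs complete) (via? E? xs p q)

-- Inclusion of Büchi automata

startAt : (A : DBA n) → Fin (states A) → DBA n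
startAt A q = record { states = states A ; δ = DBA.δ A ; q₀ = q ; final = DBA.final A }

tail : Trace n → Trace n
tail σ i = σ (suc i)

cons : Letter n → Trace n → Trace n
cons l σ zero    = l
cons l σ (suc i) = σ i

run-tail : ∀ (A : DBA n) q σ i →
  DBA.run (startAt A q) σ (suc i) ≡ DBA.run (startAt A (DBA.δ A q (σ 0))) (tail σ) i
run-tail A q σ zero    = refl
run-tail A q σ (suc i) = cong (λ p → DBA.δ A p (σ (suc i))) (run-tail A q σ i)

accepts-cons⁺ : ∀ (A : DBA n) q l σ →
  DBA.Accepts (startAt A (DBA.δ A q l)) σ → DBA.Accepts (startAt A q) (cons l σ)
accepts-cons⁺ A q l σ acc i with acc i
... | j , i≤j , fin = suc j , ≤-trans i≤j (n≤1+n j) ,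
  subst (_∈ₛ DBA.final A) (sym (run-tail A q (cons l σ) j)) fin

accepts-cons⁻ : ∀ (A : DBA n) q l σ →
  DBA.Accepts (startAt A q) (cons l σ) → DBA.Accepts (startAt A (DBA.δ A q l)) σ
-- Asking for a visit from `suc i` on rules out time 0, so that the visit corresponds to one in the
-- run on the tail.
accepts-cons⁻ A q l σ acc i with acc (suc i)
... | suc j , s≤s i≤j , fin = j , i≤j ,
  subst (_∈ₛ DBA.final A) (run-tail A q (cons l σ) j) fin

-- L(A) ⊆ L(B) fails exactly when the product has a reachable cycle through a
-- final state of A that avoids the final states of B.
module Inclusion (A B : DBA n) where

  private
    module A = DBA A
    module B = DBA B

  Q : Set
  Q = Fin A.states × Fin B.states

  step : Q → Letter n → Q
  step (p , q) l = A.δ p l , B.δ q l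

  init : Q
  init = A.q₀ , B.q₀

  Edge : Rel Q 0ℓ
  Edge p q = ∃[ l ] step p l ≡ q

  Avoid : Rel Q 0ℓ
  Avoid p q = proj₂ p ∉ₛ B.final × Edge p q

  Reachable : Q → Set
  Reachable q = init ≡ q ⊎ TransClosure Edge init q

  Bad : Q → Set
  Bad q = Reachable q × proj₁ q ∈ₛ A.final × TransClosure Avoid q q

  _≟_ : Decidable₂ {A = Q} _≡_
  _≟_ = ≡-dec _≟ᶠ_ _≟ᶠ_

  edge? : Decidable₂ Edge
  edge? p q = anySubset? (λ l → step p l ≟ q)

  productClosure? : ∀ {E : Rel Q 0ℓ} → Decidable₂ E → Decidable₂ (TransClosure E)
  productClosure? {E} E? = closure? E E? (cartesianProduct (allFin _) (allFin _))
    (λ { (p , q) → ∈-cartesianProduct⁺ (∈-allFin p) (∈-allFin q) })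

  bad? : Decidable Bad
  bad? q = ((init ≟ q) ⊎-dec productClosure? edge? init q)
    ×-dec ((proj₁ q ∈? A.final)
    ×-dec productClosure? (λ p q → ¬? (proj₂ p ∈? B.final) ×-dec edge? p q) q q)

  anyBad? : Dec (∃ Bad)
  anyBad? = mapDec (λ { (p , q , b) → (p , q) , b }) (λ { ((p , q) , b) → p , q , b })
    (any? λ p → any? λ q → bad? (p , q))

  -- A concrete trace refuting inclusion; prepending letters moves it backwards along a path, from a
  -- bad cycle to `init`.
  Separated : Q → Set
  Separated (p , q) = ∃[ σ ] (DBA.Accepts (startAt A p) σ × ¬ DBA.Accepts (startAt B q) σ)

  separated-edge : ∀ {p q} → Edge p q → Separated q → Separated p
  separated-edge (l , refl) (σ , acc , rej) =
    cons l σ , accepts-cons⁺ A _ l σ acc , rej ∘ accepts-cons⁻ B _ l σ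

  separated-path : ∀ {p q} → TransClosure Edge p q → Separated q → Separated p
  separated-path [ e ]    s = separated-edge e s
  separated-path (e ∷ es) s = separated-edge e (separated-path es s)

  module Cycle (q : Q) (q∈ : proj₁ q ∈ₛ A.final) (cycle : TransClosure Avoid q q) where

    -- A point of the unrolled cycle, with the path left before returning to q.
    Config : Set
    Config = ∃[ p ] TransClosure Avoid p q

    emit : Config → Letter n
    emit (_ , [ _ , l , _ ])    = l
    emit (_ , (_ , l , _) ∷ es) = l

    advance : Config → Config
    advance (_ , [ _ ])  = q , cycle
    advance (_ , e ∷ es) = _ , es

    config : ℕ → Config
    config zero    = q , cycle
    config (suc i) = advance (config i)

    word : Trace n
    word i = emit (config i)

    step-emit : (c : Config) → step (proj₁ c) (emit c) ≡ proj₁ (advance c)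
    step-emit (_ , [ _ , _ , eq ])    = eq
    step-emit (_ , (_ , _ , eq) ∷ es) = eq

    config-avoids : (c : Config) → proj₂ (proj₁ c) ∉ₛ B.final
    config-avoids (_ , [ ∉ , _ ])    = ∉
    config-avoids (_ , (∉ , _) ∷ es) = ∉

    run-config : ∀ i →
      (DBA.run (startAt A (proj₁ q)) word i , DBA.run (startAt B (proj₂ q)) word i) ≡ proj₁ (config i)
    run-config zero    = refl
    run-config (suc i) = trans (cong (λ p → step p (word i)) (run-config i)) (step-emit (config i))

    -- Each `advance` consumes one edge of the remaining path, so recursion on that path reaches `q`
    -- again.
    returns : ∀ i {p} (es : TransClosure Avoid p q) → config i ≡ (p , es) →
      ∃[ j ] (i ≤ j × proj₁ (config j) ≡ q)
    returns i [ e ]    eq = suc i , n≤1+n i , cong (proj₁ ∘ advance) eq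
    returns i (e ∷ es) eq with returns (suc i) es (cong advance eq)
    ... | j , i<j , eq′ = j , <⇒≤ i<j , eq′

    separated : Separated q
    separated = word , accA , rejB
      where
      accA : DBA.Accepts (startAt A (proj₁ q)) word
      accA i with returns i (proj₂ (config i)) refl
      ... | j , i≤j , eq = j , i≤j ,
        subst (_∈ₛ A.final) (sym (cong proj₁ (trans (run-config j) eq))) q∈
      rejB : ¬ DBA.Accepts (startAt B (proj₂ q)) word
      rejB acc with acc 0
      ... | j , _ , fin = config-avoids (config j)
        (subst (_∈ₛ B.final) (cong proj₂ (run-config j)) fin)

  bad⇒⊈ : ∃ Bad → ¬ (A.Accepts ⊆ B.Accepts)
  bad⇒⊈ (q , reach , q∈ , cycle) A⊆B with separated-init reach
    where
    separated-init : Reachable q → Separated init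
    separated-init (inj₁ refl) = Cycle.separated q q∈ cycle
    separated-init (inj₂ path) = separated-path path (Cycle.separated q q∈ cycle)
  ... | σ , acc , rej = rej (A⊆B acc)

  module NoBad (¬bad : ¬ ∃ Bad) (σ : Trace n) (acc : A.Accepts σ) where

    r : ℕ → Q
    r i = A.run σ i , B.run σ i

    r-reachable : ∀ i → Reachable (r i)
    r-reachable zero = inj₁ refl
    r-reachable (suc i) with r-reachable i
    ... | inj₁ eq   = inj₂ [ σ i , cong (λ q → step q (σ i)) eq ]
    ... | inj₂ path = inj₂ (path ∷ʳ (σ i , refl))

    -- The positions from `s` to just before `t` are tested one by one; `_<′_` makes the recursion
    -- append the last edge.
    segment : ∀ {s t} → s <′ t →
      (∃[ j ] (s ≤ j × B.run σ j ∈ₛ B.final)) ⊎ TransClosure Avoid (r s) (r t)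
    segment {s} ≤′-refl with B.run σ s ∈? B.final
    ... | yes ∈ = inj₁ (s , ≤-refl , ∈)
    ... | no  ∉ = inj₂ [ ∉ , σ s , refl ]
    segment {s} {suc t} (≤′-step s<t) with segment s<t
    ... | inj₁ found = inj₁ found
    ... | inj₂ path with B.run σ t ∈? B.final
    ...   | yes ∈ = inj₁ (t , <⇒≤ (≤′⇒≤ s<t) , ∈)
    ...   | no  ∉ = inj₂ (path ∷ʳ (∉ , σ t , refl))

    module _ (i : ℕ) where

      visit : ℕ → ℕ
      visit zero    = proj₁ (acc i)
      visit (suc m) = proj₁ (acc (suc (visit m)))

      visit-final : ∀ m → A.run σ (visit m) ∈ₛ A.final
      visit-final zero    = proj₂ (proj₂ (acc i))
      visit-final (suc m) = proj₂ (proj₂ (acc (suc (visit m))))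

      visit-suc : ∀ m → visit m < visit (suc m)
      visit-suc m = proj₁ (proj₂ (acc (suc (visit m))))

      visit-mono : ∀ {m m′} → m <′ m′ → visit m < visit m′
      visit-mono {m} ≤′-refl               = visit-suc m
      visit-mono {m} {suc m′} (≤′-step lt) = ≤-trans (visit-mono lt) (<⇒≤ (visit-suc m′))

      visit-≥ : ∀ m → i ≤ visit m
      visit-≥ zero    = proj₁ (proj₂ (acc i))
      visit-≥ (suc m) = ≤-trans (visit-≥ m) (<⇒≤ (visit-suc m))

      -- Among one more visits to `A.final` than there are product states, two share a product
      -- state. The segment between them is a cycle: it either meets `B.final` or would be bad.
      B-visit : ∃[ j ] (i ≤ j × B.run σ j ∈ₛ B.final)
      B-visit
        with pigeonhole (n<1+n (A.states * B.states))
               (λ m → combine (A.run σ (visit (toℕ m))) (B.run σ (visit (toℕ m))))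
      ... | x , y , x<y , eq with segment (≤⇒≤′ (visit-mono (≤⇒≤′ x<y)))
      ...   | inj₁ (j , s≤j , fin) = j , ≤-trans (visit-≥ (toℕ x)) s≤j , fin
      ...   | inj₂ path = ⊥-elim (¬bad (r s , r-reachable s , visit-final (toℕ x) ,
                subst (TransClosure Avoid (r s)) (sym same) path))
        where
        s = visit (toℕ x)
        same : r s ≡ r (visit (toℕ y))
        same with combine-injective _ _ _ _ eq
        ... | eq₁ , eq₂ = cong₂ _,_ eq₁ eq₂

  ⊆? : Dec (A.Accepts ⊆ B.Accepts)
  ⊆? with anyBad?
  ... | yes bad = no (bad⇒⊈ bad)
  ... | no ¬bad = yes (λ {σ} acc → NoBad.B-visit ¬bad σ acc)

≐? : (A B : DBA n) → Dec (DBA.Accepts A ≐ DBA.Accepts B)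
≐? A B = Inclusion.⊆? A B ×-dec Inclusion.⊆? B A

-- Minimal automata

letterCode : Letter n → Fin (2 ^ n)
letterCode l = funToFin (Inverse.from 2↔Bool ∘ lookup l)

codeLetter : Fin (2 ^ n) → Letter n
codeLetter c = tabulate (Inverse.to 2↔Bool ∘ finToFun c)

codeLetter-letterCode : (l : Letter n) → codeLetter (letterCode l) ≡ l
codeLetter-letterCode l = trans
  (tabulate-cong λ i → trans (cong (Inverse.to 2↔Bool) (finToFun-funToFin _ i))
                             (Inverse.strictlyInverseˡ 2↔Bool (lookup l i)))
  (tabulate∘lookup l)

-- A transition function is coded by a number, so that automata of a given
-- size can be enumerated without function extensionality.
fromCode : ∀ s → Fin ((s ^ 2 ^ n) ^ s) → Fin s → Subset s → DBA n
fromCode s c q f = record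
  { states = s ; δ = λ p l → finToFun (finToFun c p) (letterCode l) ; q₀ = q ; final = f }

module _ (A : DBA n) where

  private module A = DBA A

  code : Fin ((A.states ^ 2 ^ n) ^ A.states)
  code = funToFin (λ p → funToFin (λ c → A.δ p (codeLetter c)))

  decoded : DBA n
  decoded = fromCode A.states code A.q₀ A.final

  decoded-δ : ∀ p l → DBA.δ decoded p l ≡ A.δ p l
  decoded-δ p l = trans
    (cong (λ g → finToFun g (letterCode l)) (finToFun-funToFin _ p))
    (trans (finToFun-funToFin _ (letterCode l)) (cong (A.δ p) (codeLetter-letterCode l)))

  decoded-run : ∀ σ i → DBA.run decoded σ i ≡ A.run σ i
  decoded-run σ zero    = refl
  decoded-run σ (suc i) =
    trans (decoded-δ _ (σ i)) (cong (λ p → A.δ p (σ i)) (decoded-run σ i))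

  decoded-≐ : DBA.Accepts decoded ≐ A.Accepts
  decoded-≐ =
    (λ {σ} acc i → map₂ (λ {j} → map₂ (subst (_∈ₛ A.final) (decoded-run σ j))) (acc i)) ,
    (λ {σ} acc i → map₂ (λ {j} → map₂ (subst (_∈ₛ A.final) (sym (decoded-run σ j)))) (acc i))

HasDBA : Language n → ℕ → Set
HasDBA {n} L s = ∃[ A ] (states {n} A ≡ s × A Recognises L)

-- The language is given by an automaton because equality of automata is what `≐?` decides. The
-- search over codes is exhaustive since every automaton is equivalent to its decoded version.
hasDBA? : ∀ (A : DBA n) → Decidable (HasDBA (DBA.Accepts A))
hasDBA? A s = mapDec
  (λ { (c , q , f , eq) → fromCode s c q f , refl , eq })
  (λ { (B , refl , eq) → code B , DBA.q₀ B , DBA.final B , ≐-trans (decoded-≐ B) eq })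
  (any? λ c → any? λ q → anySubset? λ f → ≐? (fromCode s c q f) A)

least : ∀ {p} {P : Pred ℕ p} → Decidable P → ∀ m → P m →
  ∃[ l ] (l ≤ m × P l × (∀ j → P j → l ≤ j))
least P? zero Pm = zero , z≤n , Pm , λ _ _ → z≤n
least P? (suc m) Pm with P? zero
... | yes P0 = zero , z≤n , P0 , λ _ _ → z≤n
... | no ¬P0 with least (P? ∘ suc) m Pm
...   | l , l≤m , Pl , min =
  suc l , s≤s l≤m , Pl , λ { zero P0 → ⊥-elim (¬P0 P0) ; (suc j) Pj → s≤s (min j Pj) }

minimalDBA : ∀ {L : Language n} (A : DBA n) → A Recognises L →
  ∃[ M ] (IsMinimalDBAFor L M × states M ≤ states A)
minimalDBA A A-L with least (hasDBA? A) (states A) (A , refl , (λ a → a) , (λ a → a))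
... | _ , l≤ , (M , refl , M-A) , min =
  M , (≐-trans M-A A-L , λ B B-L → min (states B) (B , refl , ≐-trans B-L (≐-sym A-L))) , l≤

-- Automata over an arbitrary finite state type

record System (n : ℕ) : Set₁ where
  field
    {Q}       : Set
    δ         : Q → Letter n → Q
    q₀        : Q
    accepting : Q → Bool

  run : Trace n → ℕ → Q
  run σ zero    = q₀
  run σ (suc i) = δ (run σ i) (σ i)

  Accepts : Language n
  Accepts σ = ∀ i → ∃[ j ] (i ≤ j × T (accepting (run σ j)))

module _ (S : System n) {s : ℕ} (enc : System.Q S ↔ Fin s) where

  private
    module S = System S
    module E = Inverse enc

  toDBA : DBA n
  toDBA = record
    { states = s
    ; δ      = λ c l → E.to (S.δ (E.from c) l)
    ; q₀     = E.to S.q₀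
    ; final  = tabulate (S.accepting ∘ E.from)
    }

  toDBA-run : ∀ σ i → E.from (DBA.run toDBA σ i) ≡ S.run σ i
  toDBA-run σ zero    = E.strictlyInverseʳ S.q₀
  toDBA-run σ (suc i) = trans (E.strictlyInverseʳ _) (cong (λ q → S.δ q (σ i)) (toDBA-run σ i))

  toDBA-final : ∀ σ i → DBA.run toDBA σ i ∈ₛ DBA.final toDBA ⇔ T (S.accepting (S.run σ i))
  toDBA-final σ i = mk⇔
    (λ f → from T-≡ (trans (sym lookup-final) ([]=⇒lookup f)))
    (λ t → lookup⇒[]= _ _ (trans lookup-final (to T-≡ t)))
    where
    lookup-final = trans (lookup∘tabulate (S.accepting ∘ E.from) (DBA.run toDBA σ i))
                         (cong S.accepting (toDBA-run σ i))

  toDBA-≐ : DBA.Accepts toDBA ≐ S.Accepts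
  toDBA-≐ =
    (λ {σ} acc i → map₂ (λ {j} → map₂ (to (toDBA-final σ j))) (acc i)) ,
    (λ {σ} acc i → map₂ (λ {j} → map₂ (from (toDBA-final σ j))) (acc i))

-- The automaton of a formula of LTL[O]

-- Every temporal operator is treated as O; only LTL[O] is meaningful here.
State : Formula n → Set
State (pos p)  = ⊤
State (neg p)  = ⊤
State (φ ∧ ψ)  = State φ × State ψ
State (φ ∨ ψ)  = State φ × State ψ
State (op o φ) = State φ × Bool

#State : Formula n → ℕ
#State (pos p)  = 1
#State (neg p)  = 1
#State (φ ∧ ψ)  = #State φ * #State ψ
#State (φ ∨ ψ)  = #State φ * #State ψ
#State (op o φ) = #State φ * 2

State↔Fin : (φ : Formula n) → State φ ↔ Fin (#State φ)
State↔Fin (pos p)  = ↔-sym 1↔⊤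
State↔Fin (neg p)  = ↔-sym 1↔⊤
State↔Fin (φ ∧ ψ)  = ↔-trans (State↔Fin φ ×-↔ State↔Fin ψ) (↔-sym *↔×)
State↔Fin (φ ∨ ψ)  = ↔-trans (State↔Fin φ ×-↔ State↔Fin ψ) (↔-sym *↔×)
State↔Fin (op o φ) = ↔-trans (State↔Fin φ ×-↔ ↔-sym 2↔Bool) (↔-sym *↔×)

*-2^-bound : ∀ {x y} a b → x ≤ 2 ^ a → y ≤ 2 ^ b → x * y ≤ 2 ^ (a + b + 1)
*-2^-bound a b x≤ y≤ = ≤-trans (*-mono-≤ x≤ y≤)
  (≤-trans (≤-reflexive (sym (^-distribˡ-+-* 2 a b))) (^-monoʳ-≤ 2 (m≤m+n (a + b) 1)))

#State≤2^size : (φ : Formula n) → #State φ ≤ 2 ^ size φ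
#State≤2^size (pos p)  = s≤s z≤n
#State≤2^size (neg p)  = s≤s z≤n
#State≤2^size (φ ∧ ψ)  = *-2^-bound (size φ) (size ψ) (#State≤2^size φ) (#State≤2^size ψ)
#State≤2^size (φ ∨ ψ)  = *-2^-bound (size φ) (size ψ) (#State≤2^size φ) (#State≤2^size ψ)
#State≤2^size (op o φ) = ≤-trans (*-monoˡ-≤ 2 (#State≤2^size φ))
  (≤-reflexive (sym (^-distribˡ-+-* 2 (size φ) 1)))

initial : (φ : Formula n) → State φ
initial (pos p)  = tt
initial (neg p)  = tt
initial (φ ∧ ψ)  = initial φ , initial ψ
initial (φ ∨ ψ)  = initial φ , initial ψ
initial (op o φ) = initial φ , false

-- The state summarises the letters strictly before `l`. The flag of an `O` thus covers the earlier
-- positions only, and the present one is added by hand.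
holds : (φ : Formula n) → State φ → Letter n → Bool
holds (pos p)  _       l = ⌊ p ∈? l ⌋
holds (neg p)  _       l = ⌊ ¬? (p ∈? l) ⌋
holds (φ ∧ ψ)  (s , t) l = holds φ s l ∧ᵇ holds ψ t l
holds (φ ∨ ψ)  (s , t) l = holds φ s l ∨ᵇ holds ψ t l
holds (op o φ) (s , b) l = b ∨ᵇ holds φ s l

next : (φ : Formula n) → State φ → Letter n → State φ
next (pos p)  _       l = tt
next (neg p)  _       l = tt
next (φ ∧ ψ)  (s , t) l = next φ s l , next ψ t l
next (φ ∨ ψ)  (s , t) l = next φ s l , next ψ t l
next (op o φ) (s , b) l = next φ s l , b ∨ᵇ holds φ s l

after : (φ : Formula n) → Trace n → ℕ → State φ
after φ σ zero    = initial φ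
after φ σ (suc i) = next φ (after φ σ i) (σ i)

after-∧ : ∀ (φ ψ : Formula n) σ i → after (φ ∧ ψ) σ i ≡ (after φ σ i , after ψ σ i)
after-∧ φ ψ σ zero    = refl
after-∧ φ ψ σ (suc i) = cong (λ s → next (φ ∧ ψ) s (σ i)) (after-∧ φ ψ σ i)

after-∨ : ∀ (φ ψ : Formula n) σ i → after (φ ∨ ψ) σ i ≡ (after φ σ i , after ψ σ i)
after-∨ φ ψ σ zero    = refl
after-∨ φ ψ σ (suc i) = cong (λ s → next (φ ∨ ψ) s (σ i)) (after-∨ φ ψ σ i)

after-op : ∀ o (φ : Formula n) σ i → proj₁ (after (op o φ) σ i) ≡ after φ σ i
after-op o φ σ zero    = refl
after-op o φ σ (suc i) = cong (λ s → next φ s (σ i)) (after-op o φ σ i)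

module _ {φ : Formula n} {σ : Trace n}
         (φ-correct : ∀ i → (σ , i ⊨ φ) ⇔ T (holds φ (after φ σ i) (σ i))) where

  O-flag⁺ : ∀ {i j} → j < i → σ , j ⊨ φ → T (proj₂ (after (op O φ) σ i))
  O-flag⁺ {suc i} (s≤s j≤i) h with m≤n⇒m<n∨m≡n j≤i
  ... | inj₁ j<i = from T-∨ (inj₁ (O-flag⁺ j<i h))
  ... | inj₂ refl rewrite after-op O φ σ i = from T-∨ (inj₂ (to (φ-correct i) h))

  O-flag⁻ : ∀ i → T (proj₂ (after (op O φ) σ i)) → ∃[ j ] (j < i × σ , j ⊨ φ)
  O-flag⁻ (suc i) t with to T-∨ t
  ... | inj₁ t′ = let j , j<i , h = O-flag⁻ i t′ in j , m≤n⇒m≤1+n j<i , h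
  ... | inj₂ t′ rewrite after-op O φ σ i = i , ≤-refl , from (φ-correct i) t′

holds-correct : ∀ {φ : Formula n} → LTL[ O ∷ [] ] φ → ∀ σ i →
  (σ , i ⊨ φ) ⇔ T (holds φ (after φ σ i) (σ i))
holds-correct (pos p) σ i = mk⇔ fromWitness toWitness
holds-correct (neg p) σ i = mk⇔ fromWitness toWitness
holds-correct {φ = φ ∧ ψ} (a ∧ b) σ i rewrite after-∧ φ ψ σ i =
  ⇔-trans (holds-correct a σ i ×-⇔ holds-correct b σ i) (⇔-sym T-∧)
holds-correct {φ = φ ∨ ψ} (a ∨ b) σ i rewrite after-∨ φ ψ σ i =
  ⇔-trans (holds-correct a σ i ⊎-⇔ holds-correct b σ i) (⇔-sym T-∨)
-- After i + 1 letters the flag of O φ is the current value of O φ at i.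
holds-correct {φ = op O φ} (op (here refl) a) σ i = mk⇔
  (λ { (j , j≤i , h) → O-flag⁺ (holds-correct a σ) (s≤s j≤i) h })
  (λ t → let j , j<1+i , h = O-flag⁻ (holds-correct a σ) (suc i) t in j , s≤s⁻¹ j<1+i , h)

-- Shifting traces

suffix : ℕ → Trace n → Trace n
suffix d σ j = σ (j + d)

-- A witness for `O` survives when letters are added in front, and a literal sees only its own
-- letter. The converse fails, as a witness may lie among the added letters. Relating `τ` and `σ`
-- pointwise avoids function extensionality.
past-extend : ∀ {φ : Formula n} → LTL[ O ∷ [] ] φ → ∀ {τ σ} d → (∀ j → τ j ≡ σ (j + d)) →
  ∀ i → τ , i ⊨ φ → σ , i + d ⊨ φ
past-extend (pos p) d eq i h = subst (p ∈ₛ_) (eq i) h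
past-extend (neg p) d eq i h = h ∘ subst (p ∈ₛ_) (sym (eq i))
past-extend (a ∧ b) d eq i (h , k) = past-extend a d eq i h , past-extend b d eq i k
past-extend (a ∨ b) d eq i (inj₁ h) = inj₁ (past-extend a d eq i h)
past-extend (a ∨ b) d eq i (inj₂ h) = inj₂ (past-extend b d eq i h)
past-extend (op (here refl) a) d eq i (j , j≤i , h) =
  j + d , +-monoˡ-≤ d j≤i , past-extend a d eq j h

future-shift : ∀ {ψ : Formula n} → LTL[ X ∷ wX ∷ F ∷ G ∷ [] ] ψ → ∀ σ d i →
  (suffix d σ , i ⊨ ψ) ⇔ (σ , i + d ⊨ ψ)
future-shift (pos p) σ d i = ⇔-refl
future-shift (neg p) σ d i = ⇔-refl
future-shift (a ∧ b) σ d i = future-shift a σ d i ×-⇔ future-shift b σ d i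
future-shift (a ∨ b) σ d i = future-shift a σ d i ⊎-⇔ future-shift b σ d i
future-shift (op (here refl) a) σ d i = future-shift a σ d (suc i)
future-shift (op (there (here refl)) a) σ d i = future-shift a σ d (suc i)
future-shift {ψ = op F ψ} (op (there (there (here refl))) a) σ d i = mk⇔
  (λ { (j , i≤j , h) → j + d , +-monoˡ-≤ d i≤j , to (future-shift a σ d j) h })
  (λ { (j , i+d≤j , h) → j ∸ d , m+n≤o⇒m≤o∸n i i+d≤j , from (future-shift a σ d (j ∸ d))
         (subst (σ ,_⊨ ψ) (sym (m∸n+n≡m (≤-trans (m≤n+m d i) i+d≤j))) h) })
future-shift {ψ = op G ψ} (op (there (there (there (here refl)))) a) σ d i = mk⇔
  (λ h j i+d≤j → subst (σ ,_⊨ ψ) (m∸n+n≡m (≤-trans (m≤n+m d i) i+d≤j))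
     (to (future-shift a σ d (j ∸ d)) (h (j ∸ d) (m+n≤o⇒m≤o∸n i i+d≤j))))
  (λ h j i≤j → from (future-shift a σ d j) (h (j + d) (+-monoˡ-≤ d i≤j)))

-- Normal form of the prefixed formulae

infix 4 _≋_

-- Agreement at all positions, because `_≡ω_` concerns position 0 only and is not a congruence for
-- the operators. The record lets both formulae be inferred.
record _≋_ (χ χ′ : Formula n) : Set where
  field
    at : ∀ σ i → (σ , i ⊨ χ) ⇔ (σ , i ⊨ χ′)

open _≋_

≋-refl : {χ : Formula n} → χ ≋ χ
≋-refl .at σ i = ⇔-refl

≋-trans : {χ χ′ χ″ : Formula n} → χ ≋ χ′ → χ′ ≋ χ″ → χ ≋ χ″
≋-trans p q .at σ i = ⇔-trans (at p σ i) (at q σ i)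

≋⇒≡ω : {χ χ′ : Formula n} → χ ≋ χ′ → χ ≡ω χ′
≋⇒≡ω p = (λ {σ} → to (at p σ 0)) , (λ {σ} → from (at p σ 0))

op-cong : ∀ o {χ χ′ : Formula n} → χ ≋ χ′ → op o χ ≋ op o χ′
op-cong X  p .at σ i = at p σ (suc i)
op-cong wX p .at σ i = at p σ (suc i)
op-cong F  p .at σ i = mk⇔ (map₂ (λ {j} → map₂ (to (at p σ j)))) (map₂ (λ {j} → map₂ (from (at p σ j))))
op-cong G  p .at σ i = mk⇔ (λ h j i≤j → to (at p σ j) (h j i≤j)) (λ h j i≤j → from (at p σ j) (h j i≤j))
op-cong O  p .at σ i = mk⇔ (map₂ (λ {j} → map₂ (to (at p σ j)))) (map₂ (λ {j} → map₂ (from (at p σ j))))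

record BackwardClosed (χ : Formula n) : Set where
  field
    backward : ∀ {σ i j} → i ≤ j → σ , j ⊨ χ → σ , i ⊨ χ

open BackwardClosed

F-absorb : ∀ {χ : Formula n} → BackwardClosed χ → op F χ ≋ χ
F-absorb bc .at σ i = mk⇔ (λ { (j , i≤j , h) → backward bc i≤j h }) (λ h → i , ≤-refl , h)

X^ : ℕ → Formula n → Formula n
X^ zero    ψ = ψ
X^ (suc m) ψ = op X (X^ m ψ)

X^-LTL : ∀ {S} {ψ : Formula n} → X ∈ S → ∀ m → LTL[ S ] ψ → LTL[ S ] (X^ m ψ)
X^-LTL X∈ zero    a = a
X^-LTL X∈ (suc m) a = op X∈ (X^-LTL X∈ m a)

X^-sem : ∀ m {ψ : Formula n} σ i → (σ , i ⊨ X^ m ψ) ⇔ (σ , m + i ⊨ ψ)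
X^-sem zero    σ i = ⇔-refl
X^-sem (suc m) {ψ} σ i = subst (λ k → (σ , suc i ⊨ X^ m ψ) ⇔ (σ , k ⊨ ψ)) (+-suc m i) (X^-sem m σ (suc i))

module _ {ψ : Formula n} (bc : BackwardClosed ψ) where

  X^-backwardClosed : ∀ m → BackwardClosed (X^ m ψ)
  X^-backwardClosed m .backward {σ} {i} {j} i≤j h =
    from (X^-sem m σ i) (backward bc (+-monoʳ-≤ m i≤j) (to (X^-sem m σ j) h))

  G-backwardClosed : BackwardClosed (op G ψ)
  -- The position `j + l` is late enough for `G ψ` at `j` to apply, and lies at or after `l`.
  G-backwardClosed .backward {j = j} _ h l _ = backward bc (m≤n+m l j) (h (j + l) (m≤m+n j l))

  G-X^ : ∀ m → op G (X^ m ψ) ≋ op G ψ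
  G-X^ m .at σ i = mk⇔
    (λ h j i≤j → backward bc (m≤n+m j m) (to (X^-sem m σ j) (h j i≤j)))
    (λ h j i≤j → from (X^-sem m σ j) (h (m + j) (≤-trans i≤j (m≤n+m j m))))

  X-G : op X (op G ψ) ≋ op G ψ
  X-G .at σ i = mk⇔ (backward G-backwardClosed (n≤1+n i)) (λ h j i<j → h j (<⇒≤ i<j))

  G-G : op G (op G ψ) ≋ op G ψ
  G-G .at σ i = mk⇔ (λ h → h i ≤-refl) (λ h j i≤j l j≤l → h l (≤-trans i≤j j≤l))

  -- Induction from the innermost operator outwards: `X` raises the exponent and `F` is absorbed,
  -- until a first `G` erases the exponent and absorbs everything outside it.
  normalForm : ∀ {k} (Π : Vec Op k) → All (_∈ (X ∷ F ∷ G ∷ [])) Π →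
    (∃[ m ] (m ≤ k × prefix Π ψ ≋ X^ m ψ)) ⊎ (prefix Π ψ ≋ op G ψ)
  normalForm [] [] = inj₁ (0 , z≤n , ≋-refl)
  normalForm (_ ∷ Π) (here refl ∷ os) with normalForm Π os
  ... | inj₁ (m , m≤k , eq) = inj₁ (suc m , s≤s m≤k , op-cong X eq)
  ... | inj₂ eq             = inj₂ (≋-trans (op-cong X eq) X-G)
  normalForm (_ ∷ Π) (there (here refl) ∷ os) with normalForm Π os
  ... | inj₁ (m , m≤k , eq) =
    inj₁ (m , m≤n⇒m≤1+n m≤k , ≋-trans (op-cong F eq) (F-absorb (X^-backwardClosed m)))
  ... | inj₂ eq             = inj₂ (≋-trans (op-cong F eq) (F-absorb G-backwardClosed))
  normalForm (_ ∷ Π) (there (there (here refl)) ∷ os) with normalForm Π os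
  ... | inj₁ (m , m≤k , eq) = inj₂ (≋-trans (op-cong G eq) (G-X^ m))
  ... | inj₂ eq             = inj₂ (≋-trans (op-cong G eq) G-G)

-- Automata for the normal forms

-- The fresh state `zero` swallows the first letter and is never entered again, so it cannot affect
-- Büchi acceptance.
nextDBA : DBA n → DBA n
nextDBA A = record
  { states = suc (states A)
  ; δ      = λ { zero l → suc (DBA.q₀ A) ; (suc q) l → suc (DBA.δ A q l) }
  ; q₀     = zero
  ; final  = outside ∷ DBA.final A
  }

nextDBA-run : ∀ (A : DBA n) σ i → DBA.run (nextDBA A) σ (suc i) ≡ suc (DBA.run A (suffix 1 σ) i)
nextDBA-run A σ zero    = refl
nextDBA-run A σ (suc i) rewrite nextDBA-run A σ i =
  cong (λ j → suc (DBA.δ A (DBA.run A (suffix 1 σ) i) (σ j))) (+-comm 1 i)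

nextDBA-accepts : ∀ (A : DBA n) σ → DBA.Accepts (nextDBA A) σ ⇔ DBA.Accepts A (suffix 1 σ)
nextDBA-accepts A σ = mk⇔ acc⇒ acc⇐
  where
  acc⇒ : DBA.Accepts (nextDBA A) σ → DBA.Accepts A (suffix 1 σ)
  acc⇒ acc i with acc (suc i)
  ... | suc j , s≤s i≤j , fin =
    j , i≤j , drop-there (subst (_∈ₛ outside ∷ DBA.final A) (nextDBA-run A σ j) fin)
  acc⇐ : DBA.Accepts A (suffix 1 σ) → DBA.Accepts (nextDBA A) σ
  acc⇐ acc i with acc i
  ... | j , i≤j , fin = suc j , m≤n⇒m≤1+n i≤j ,
    subst (_∈ₛ outside ∷ DBA.final A) (sym (nextDBA-run A σ j)) (there fin)

nextDBA-recognises : ∀ {χ : Formula n} → LTL[ X ∷ wX ∷ F ∷ G ∷ [] ] χ → ∀ A →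
  A Recognises ℒω χ → nextDBA A Recognises ℒω (op X χ)
nextDBA-recognises χ-future A (A⊆χ , χ⊆A) =
  (λ {σ} acc → to (future-shift χ-future σ 1 0) (A⊆χ (to (nextDBA-accepts A σ) acc))) ,
  (λ {σ} h → from (nextDBA-accepts A σ) (χ⊆A (from (future-shift χ-future σ 1 0) h)))

nextDBAs : ℕ → DBA n → DBA n
nextDBAs zero    A = A
nextDBAs (suc m) A = nextDBA (nextDBAs m A)

nextDBAs-recognises : ∀ {χ : Formula n} → LTL[ X ∷ wX ∷ F ∷ G ∷ [] ] χ → ∀ {A} →
  A Recognises ℒω χ → ∀ m → nextDBAs m A Recognises ℒω (X^ m χ)
nextDBAs-recognises χ-future A-χ zero    = A-χ
nextDBAs-recognises χ-future A-χ (suc m) =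
  nextDBA-recognises (X^-LTL (here refl) m χ-future) _ (nextDBAs-recognises χ-future A-χ m)

states-nextDBAs : ∀ m (A : DBA n) → states (nextDBAs m A) ≡ m + states A
states-nextDBAs zero    A = refl
states-nextDBAs (suc m) A = cong suc (states-nextDBAs m A)

module _ {α : Formula n} (α-past : LTL[ O ∷ [] ] α) where

  -- The flag of `O α` never falls once raised, so it is up infinitely often iff `α` holds
  -- somewhere.
  onceSystem : System n
  onceSystem = record { δ = next (op O α) ; q₀ = initial (op O α) ; accepting = proj₂ }

  onceSystem-run : ∀ σ i → System.run onceSystem σ i ≡ after (op O α) σ i
  onceSystem-run σ zero    = refl
  onceSystem-run σ (suc i) = cong (λ s → next (op O α) s (σ i)) (onceSystem-run σ i)

  onceSystem-≐ : System.Accepts onceSystem ≐ ℒω (op F α)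
  onceSystem-≐ = acc⇒ , acc⇐
    where
    acc⇒ : ∀ {σ} → System.Accepts onceSystem σ → ℒω (op F α) σ
    acc⇒ {σ} acc with acc 0
    ... | j , _ , t
      with O-flag⁻ (holds-correct α-past σ) j (subst (T ∘ proj₂) (onceSystem-run σ j) t)
    ...   | i , _ , h = i , z≤n , h
    acc⇐ : ∀ {σ} → ℒω (op F α) σ → System.Accepts onceSystem σ
    -- The flag records positions strictly before the current one, so it is surely up from `suc j`
    -- on.
    acc⇐ {σ} (j , _ , h) i = i + suc j , m≤m+n i (suc j) ,
      subst (T ∘ proj₂) (sym (onceSystem-run σ (i + suc j)))
        (O-flag⁺ (holds-correct α-past σ) (m≤n+m (suc j) i) h)

  -- Looks for α from a fresh start after each success; the flag marks the successes.
  resetStep : State α × Bool → Letter n → State α × Bool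
  resetStep (s , _) l = if holds α s l then (initial α , true) else (next α s l , false)

  resetSystem : System n
  resetSystem = record { δ = resetStep ; q₀ = initial α , false ; accepting = proj₂ }

  module Reset (σ : Trace n) where

    R : ℕ → State α × Bool
    R = System.run resetSystem σ

    -- At time d + r the last restart was at time r.
    Since : ℕ → ℕ → Set
    Since r d = proj₁ (R (d + r)) ≡ after α (suffix r σ) d

    -- Reading the letter at time `d + r` either raises the flag and restarts the search one
    -- position later, or lowers the flag and continues the search begun at `r`.
    data Step (r d : ℕ) : Set where
      success : suffix r σ , d ⊨ α → T (proj₂ (R (suc d + r))) → Since (suc d + r) 0 → Step r d
      failure : ¬ (suffix r σ , d ⊨ α) → ¬ T (proj₂ (R (suc d + r))) → Since r (suc d) → Step r d

    step : ∀ r d → Since r d → Step r d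
    step r d since with holds α (proj₁ (R (d + r))) (σ (d + r)) in eq
    ... | true  = success
      (from correct (from T-≡ eq′))
      (subst (T ∘ proj₂) (sym R-suc) tt)
      (cong proj₁ R-suc)
      where
      correct = holds-correct α-past (suffix r σ) d
      eq′ : holds α (after α (suffix r σ) d) (σ (d + r)) ≡ true
      eq′ = subst (λ s → holds α s (σ (d + r)) ≡ true) since eq
      R-suc : R (suc d + r) ≡ (initial α , true)
      R-suc rewrite eq = refl
    ... | false = failure
      (λ h → subst T eq′ (to correct h))
      (λ t → subst (T ∘ proj₂) R-suc t)
      (trans (cong proj₁ R-suc) (cong (λ s → next α s (σ (d + r))) since))
      where
      correct = holds-correct α-past (suffix r σ) d
      eq′ : holds α (after α (suffix r σ) d) (σ (d + r)) ≡ false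
      eq′ = subst (λ s → holds α s (σ (d + r)) ≡ false) since eq
      R-suc : R (suc d + r) ≡ (next α (proj₁ (R (d + r))) (σ (d + r)) , false)
      R-suc rewrite eq = refl

    -- Induction on the elapsed time `e`: a success moves the restart to the present, a failure
    -- lengthens `d`.
    lastRestart : ∀ r → Since r 0 → ∀ e → ∃[ r′ ] ∃[ d ] (e + r ≡ d + r′ × r ≤ r′ × Since r′ d)
    lastRestart r since zero    = r , 0 , refl , ≤-refl , since
    lastRestart r since (suc e) with lastRestart r since e
    ... | r′ , d , eq , r≤r′ , since′ with step r′ d since′
    ...   | success _ _ since″ =
      suc d + r′ , 0 , cong suc eq , ≤-trans r≤r′ (m≤n+m r′ (suc d)) , since″
    ...   | failure _ _ since″ = r′ , suc d , cong suc eq , r≤r′ , since″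

    -- The flag is down at time 0 and is raised only by a success, which also restarts the search.
    flagged⇒restart : ∀ j → T (proj₂ (R j)) → Since j 0
    flagged⇒restart (suc j) t with lastRestart 0 refl j
    ... | r , d , eq , _ , since rewrite +-identityʳ j | eq with step r d since
    ...   | success _ _ since′ = since′
    ...   | failure _ ¬t _     = ⊥-elim (¬t t)

    -- Here `t` bounds the wait: the search may succeed earlier, and at the latest it succeeds when
    -- `t` reaches zero.
    eventually-flagged : ∀ r t d → Since r d → suffix r σ , t + d ⊨ α →
      ∃[ j ] (d + r ≤ j × T (proj₂ (R j)))
    eventually-flagged r t d since h with step r d since
    eventually-flagged r t d since h       | success _ flag _ = suc d + r , n≤1+n _ , flag
    eventually-flagged r zero d since h    | failure ¬h _ _ = ⊥-elim (¬h h)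
    eventually-flagged r (suc t) d since h | failure _ _ since′
      with eventually-flagged r t (suc d) since′ (subst (suffix r σ ,_⊨ α) (sym (+-suc t d)) h)
    ...   | j , d+r<j , flag = j , <⇒≤ d+r<j , flag

    -- A first flag at `r` fixes a restart at or after `i`. The next flag ends a search begun at
    -- some `r′ ≥ r`, and its success is a witness for `F α` on the suffix from `r′`.
    accepts⇒ : System.Accepts resetSystem σ → ∀ i → ∃[ r ] (i ≤ r × ℒω (op F α) (suffix r σ))
    accepts⇒ acc i with acc i
    ... | r , i≤r , flag with acc (suc r)
    ...   | suc j , s≤s r≤j , flag′ with lastRestart r (flagged⇒restart r flag) (j ∸ r)
    ...     | r′ , d , eq , r≤r′ , since
      rewrite m∸n+n≡m r≤j | eq with step r′ d since
    ...       | success h _ _  = r′ , ≤-trans i≤r r≤r′ , d , z≤n , h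
    ...       | failure _ ¬t _ = ⊥-elim (¬t flag′)

    -- At time `i` the current search has already read `d` letters. A witness for `α` on the suffix
    -- from `i` is still valid with these letters in front, by `past-extend`, so the search must
    -- succeed.
    accepts⇐ : (∀ i → ℒω (op F α) (suffix i σ)) → System.Accepts resetSystem σ
    accepts⇐ always i with lastRestart 0 refl i
    ... | r , d , eq , _ , since rewrite +-identityʳ i | eq with always (d + r)
    ...   | t , _ , h = eventually-flagged r t d since
      (past-extend α-past d (λ j → cong σ (sym (+-assoc j d r))) t h)

  module _ {ψ : Formula n} (ψ-future : LTL[ X ∷ wX ∷ F ∷ G ∷ [] ] ψ) (φ≡ψ : op F α ≡ω ψ) where

    -- The hypothesis speaks of position 0 only; as `ψ` is a pure future formula, cutting off a
    -- prefix carries it to every position.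
    ψ-at : ∀ σ i → ℒω (op F α) (suffix i σ) ⇔ (σ , i ⊨ ψ)
    ψ-at σ i = ⇔-trans (mk⇔ (proj₁ φ≡ψ) (proj₂ φ≡ψ)) (future-shift ψ-future σ i 0)

    ψ-backwardClosed : BackwardClosed ψ
    ψ-backwardClosed .backward {σ} {i} {j} i≤j h with from (ψ-at σ j) h
    -- The suffix from `i` has `j ∸ i` more letters in front than the one from `j`, which moves the
    -- witness `t` by that amount.
    ... | t , _ , k = to (ψ-at σ i) (t + (j ∸ i) , z≤n , past-extend α-past (j ∸ i) shifted t k)
      where
      shifted : ∀ l → suffix j σ l ≡ suffix i σ (l + (j ∸ i))
      shifted l = cong σ (trans (cong (l +_) (sym (m∸n+n≡m i≤j))) (sym (+-assoc l (j ∸ i) i)))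

    resetSystem-≐ : System.Accepts resetSystem ≐ ℒω (op G ψ)
    resetSystem-≐ =
      -- Acceptance yields `ψ` only at arbitrarily late positions; backward closure fills in all
      -- earlier ones.
      (λ {σ} acc i _ → let r , i≤r , h = Reset.accepts⇒ σ acc i
                       in backward ψ-backwardClosed i≤r (to (ψ-at σ r) h)) ,
      (λ {σ} h → Reset.accepts⇐ σ (λ i → from (ψ-at σ i) (h i z≤n)))

    -- `State` treats all operators alike, so `#State (op F α)` also counts the states built for
    -- `op O α`: those of `α` and one bit.
    smallDBA : ∀ {k} (Π : Vec Op k) → All (_∈ (X ∷ F ∷ G ∷ [])) Π →
      ∃[ A ] (A Recognises ℒω (prefix Π ψ) × states A ≤ k + #State (op F α))
    smallDBA {k} Π os with normalForm ψ-backwardClosed Π os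
    ... | inj₁ (m , m≤k , eq) =
      nextDBAs m A ,
      ≐-trans (nextDBAs-recognises ψ-future A-ψ m) (≐-sym (≋⇒≡ω eq)) ,
      ≤-trans (≤-reflexive (states-nextDBAs m A)) (+-monoˡ-≤ _ m≤k)
      where
      A = toDBA onceSystem (State↔Fin (op O α))
      A-ψ : A Recognises ℒω ψ
      A-ψ = ≐-trans (toDBA-≐ onceSystem (State↔Fin (op O α))) (≐-trans onceSystem-≐ φ≡ψ)
    ... | inj₂ eq =
      toDBA resetSystem (State↔Fin (op O α)) ,
      ≐-trans (toDBA-≐ resetSystem (State↔Fin (op O α))) (≐-trans resetSystem-≐ (≐-sym (≋⇒≡ω eq))) ,
      m≤n+m _ k

-- The state bound and the conclusion

k+m≤[k+1]*2^s : ∀ k {m} s → m ≤ 2 ^ s → k + m ≤ (k + 1) * 2 ^ s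
k+m≤[k+1]*2^s k {m} s m≤ = begin
  k + m                 ≤⟨ +-mono-≤ (m≤m*n k (2 ^ s) {{m^n≢0 2 s}}) m≤ ⟩
  k * 2 ^ s + 2 ^ s     ≡⟨ cong (k * 2 ^ s +_) (sym (*-identityˡ (2 ^ s))) ⟩
  k * 2 ^ s + 1 * 2 ^ s ≡⟨ sym (*-distribʳ-+ (2 ^ s) k 1) ⟩
  (k + 1) * 2 ^ s       ∎
  where open ≤-Reasoning

theorem4 : ∃[ c ] (0 < c ×
    (∀ (n k : ℕ) (Π : Vec Op k) → All (λ o → o ∈ (X ∷ F ∷ G ∷ [])) Π →
    (φ ψ : Formula n) →
    F⟨LTL[ O ∷ [] ]⟩ φ → LTL[ X ∷ wX ∷ F ∷ G ∷ [] ] ψ → φ ≡ω ψ →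
    ∃[ A ] (IsMinimalDBAFor (ℒω (prefix Π ψ)) A ×
    states A ≤ (k + 1) * 2 ^ (c * size φ))))
-- The constant 1 suffices: one bit per temporal operator of `φ` gives at most `2 ^ size φ` states
-- before the cost of the prefix.
theorem4 = 1 , s≤s z≤n , proof
  where
  proof : ∀ (n k : ℕ) (Π : Vec Op k) → All (λ o → o ∈ (X ∷ F ∷ G ∷ [])) Π →
    (φ ψ : Formula n) →
    F⟨LTL[ O ∷ [] ]⟩ φ → LTL[ X ∷ wX ∷ F ∷ G ∷ [] ] ψ → φ ≡ω ψ →
    ∃[ A ] (IsMinimalDBAFor (ℒω (prefix Π ψ)) A ×
    states A ≤ (k + 1) * 2 ^ (1 * size φ))
  proof n k Π os φ ψ (F α-past) ψ-future φ≡ψ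
    with smallDBA α-past ψ-future φ≡ψ Π os
  ... | A , A-L , A≤ with minimalDBA A A-L
  ...   | M , minimal , M≤A = M , minimal ,
    ≤-trans M≤A (≤-trans A≤ (k+m≤[k+1]*2^s k (1 * size φ)
      (subst (λ s → #State φ ≤ 2 ^ s) (sym (*-identityˡ (size φ))) (#State≤2^size φ))))
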